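{- Let $V$ be a finite set and let $\mathcal{A}$, $\mathcal{B}$ be families of subsets of $V$ such that $|A \cap B| \le 1$ holds for all $A \in \mathcal{A}$ and $B \in \mathcal{B}$. Then $|\mathcal{A}| \cdot |\mathcal{B}| \le (|V|+1)\, 2^{|V|}$.
   Context: A family of subsets of $V$ is a set of subsets of $V$ (no repetitions). -}

module Defs where

{-# OPTIONS --safe #-}
-- The bound is proved for |A ∩ B| < k by induction on |V|. Fixing x ∈ V splits 𝒜 into the traces
-- 𝒜₀, 𝒜₁ on V ∖ {x} of its members avoiding, resp. containing, x; likewise ℬ. The families
-- 𝒜₀ ∪ 𝒜₁ and ℬ₀ ∪ ℬ₁ still satisfy |A ∩ B| < k, whereas 𝒜₀ ∩ 𝒜₁ and ℬ₀ ∩ ℬ₁ satisfy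
-- |A ∩ B| < k - 1, as x can be added to both sets. With u, i the sizes of the union and the
-- intersection for 𝒜, and v, j those for ℬ, we have i ≤ u and j ≤ v, so Chebyshev's inequality gives
-- |𝒜| |ℬ| = (u + i)(v + j) ≤ 2 (uv + ij), which matches Pascal's recursion for the bound.
module Submission where

open import Defs
open import Data.Nat using (ℕ; _+_; _*_; _^_; _≤_)
open import Data.Fin.Subset using (Subset; _∩_; ∣_∣)
open import Data.List using (List; length)
open import Data.List.Membership.Propositional using (_∈_)
open import Data.List.Relation.Unary.Unique.Propositional using (Unique)

open import Data.Nat using (zero; suc; pred; _<_; z≤n; s≤s)
open import Data.Nat.Properties hiding (_≟_)
open import Data.Nat.Tactic.RingSolver using (solve-∀)
open import Data.Bool using (if_then_else_)
import Data.Bool.Properties as Bool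
open import Data.Empty using (⊥-elim)
open import Data.Fin.Subset using (outside; inside)
open import Data.List using ([]; _∷_)
open import Data.List.Membership.DecPropositional using () renaming (_∈?_ to member?)
open import Data.List.Relation.Unary.All using (lookup)
open import Data.List.Relation.Unary.AllPairs using ([]; _∷_)
open import Data.List.Relation.Unary.Any using (here; there)
open import Data.Product using (_,_)
open import Data.Sum using (inj₁; inj₂; [_,_])
open import Data.Vec using ([]; _∷_)
open import Data.Vec.Properties using (≡-dec)
open import Function using (_∘_)
open import Level using (Level)
open import Relation.Binary using (DecidableEquality)
open import Relation.Binary.PropositionalEquality
  using (_≡_; refl; trans; cong; cong₂)
open import Relation.Nullary using (¬_; Dec; yes; no; does)
open import Relation.Unary using (Pred; Decidable; _⊆_)
open import Relation.Unary.Properties using (_∪?_; _∩?_)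

private variable
  n : ℕ
  ℓ ℓ′ : Level

-- A family is represented by a decidable predicate and counted by recursion on the coordinates.
-- Splitting on the first element of the ground set then holds by definition, and unions and
-- intersections of families are those of predicates.
count : {P : Pred (Subset n) ℓ} → Decidable P → ℕ
count {n = zero}  P? = if does (P? []) then 1 else 0
count {n = suc _} P? = count (P? ∘ (outside ∷_)) + count (P? ∘ (inside ∷_))

count-∪-∩ : {P : Pred (Subset n) ℓ} {Q : Pred (Subset n) ℓ′}
  (P? : Decidable P) (Q? : Decidable Q) →
  count P? + count Q? ≡ count (P? ∪? Q?) + count (P? ∩? Q?)
count-∪-∩ {n = zero} P? Q? with P? [] | Q? []
... | yes _ | yes _ = refl
... | yes _ | no  _ = refl
... | no  _ | yes _ = refl
... | no  _ | no  _ = refl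
count-∪-∩ {n = suc _} P? Q? =
  trans (interchange (count (P? ∘ (outside ∷_))) _ _ _)
    (trans (cong₂ _+_ (count-∪-∩ (P? ∘ (outside ∷_)) (Q? ∘ (outside ∷_)))
                      (count-∪-∩ (P? ∘ (inside ∷_)) (Q? ∘ (inside ∷_))))
      (interchange (count ((P? ∪? Q?) ∘ (outside ∷_))) _ _ _))
  where
  interchange : ∀ a b c d → (a + b) + (c + d) ≡ (a + c) + (b + d)
  interchange = solve-∀

count-mono : {P : Pred (Subset n) ℓ} {Q : Pred (Subset n) ℓ′}
  (P? : Decidable P) (Q? : Decidable Q) → P ⊆ Q → count P? ≤ count Q?
count-mono {n = zero} P? Q? P⊆Q with P? [] | Q? []
... | yes _ | yes _ = ≤-refl
... | yes p | no ¬q = ⊥-elim (¬q (P⊆Q p))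
... | no  _ | _     = z≤n
count-mono {n = suc _} P? Q? P⊆Q =
  +-mono-≤ (count-mono (P? ∘ (outside ∷_)) (Q? ∘ (outside ∷_)) P⊆Q)
           (count-mono (P? ∘ (inside ∷_)) (Q? ∘ (inside ∷_)) P⊆Q)

count-empty : {P : Pred (Subset n) ℓ} (P? : Decidable P) → (∀ A → ¬ P A) → count P? ≡ 0
count-empty {n = zero} P? ¬P with P? []
... | yes p = ⊥-elim (¬P [] p)
... | no  _ = refl
count-empty {n = suc _} P? ¬P =
  cong₂ _+_ (count-empty (P? ∘ (outside ∷_)) (¬P ∘ (outside ∷_)))
            (count-empty (P? ∘ (inside ∷_)) (¬P ∘ (inside ∷_)))

count-nonempty : {P : Pred (Subset n) ℓ} (P? : Decidable P) (A : Subset n) → P A → 1 ≤ count P?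
count-nonempty P? [] p with P? []
... | yes _ = ≤-refl
... | no ¬p = ⊥-elim (¬p p)
count-nonempty P? (outside ∷ A) p = m≤n⇒m≤n+o _ (count-nonempty (P? ∘ (outside ∷_)) A p)
count-nonempty P? (inside  ∷ A) p = m≤n⇒m≤o+n _ (count-nonempty (P? ∘ (inside ∷_)) A p)

_≟_ : DecidableEquality (Subset n)
_≟_ = ≡-dec Bool._≟_

_∈?_ : (A : Subset n) (𝒜 : List (Subset n)) → Dec (A ∈ 𝒜)
_∈?_ = member? _≟_

-- This passes from lists to predicates. Uniqueness makes the head disjoint from the tail, so the
-- intersection term of inclusion-exclusion vanishes and each entry contributes at least one.
length≤count : (𝒜 : List (Subset n)) → Unique 𝒜 → length 𝒜 ≤ count (_∈? 𝒜)
length≤count []      _                  = z≤n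
length≤count (A ∷ 𝒜) (A∉𝒜 ∷ unique) = begin
  1 + length 𝒜                                   ≤⟨ +-mono-≤ (count-nonempty ≡A? A refl) (length≤count 𝒜 unique) ⟩
  count ≡A? + count (_∈? 𝒜)                      ≡⟨ count-∪-∩ ≡A? (_∈? 𝒜) ⟩
  count (≡A? ∪? (_∈? 𝒜)) + count (≡A? ∩? (_∈? 𝒜)) ≡⟨ cong (count (≡A? ∪? (_∈? 𝒜)) +_) disjoint ⟩
  count (≡A? ∪? (_∈? 𝒜)) + 0                     ≡⟨ +-identityʳ _ ⟩
  count (≡A? ∪? (_∈? 𝒜))                         ≤⟨ count-mono (≡A? ∪? (_∈? 𝒜)) (_∈? (A ∷ 𝒜)) [ here , there ] ⟩
  count (_∈? (A ∷ 𝒜))                            ∎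
  where
  open ≤-Reasoning
  ≡A? : Decidable (_≡ A)
  ≡A? = _≟ A
  disjoint : count (≡A? ∩? (_∈? 𝒜)) ≡ 0
  disjoint = count-empty (≡A? ∩? (_∈? 𝒜)) λ { _ (refl , A∈𝒜) → lookup A∉𝒜 A∈𝒜 refl }

-- With `u = i + p` and `v = j + q`, the right side exceeds the left by exactly `p * q`.
chebyshev : ∀ {u i v j} → i ≤ u → j ≤ v → (u + i) * (v + j) ≤ 2 * (u * v + i * j)
chebyshev {i = i} {j = j} i≤u j≤v with m≤n⇒∃[o]m+o≡n i≤u | m≤n⇒∃[o]m+o≡n j≤v
... | p , refl | q , refl = m+n≤o⇒m≤o _ (≤-reflexive (identity i p j q))
  where
  identity : ∀ i p j q →
    ((i + p) + i) * ((j + q) + j) + p * q ≡ 2 * ((i + p) * (j + q) + i * j)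
  identity = solve-∀

-- The number of subsets of an n-set with fewer than k elements.
ball : ℕ → ℕ → ℕ
ball zero    zero    = 0
ball zero    (suc _) = 1
ball (suc n) k       = ball n k + ball n (pred k)

-- Since `pred 0` is `0`, the recursion stays at `k = 0` and ends in zeros only.
ball-0 : ∀ n → ball n 0 ≡ 0
ball-0 zero    = refl
ball-0 (suc n) = cong₂ _+_ (ball-0 n) (ball-0 n)

ball-1 : ∀ n → ball n 1 ≡ 1
ball-1 zero    = refl
ball-1 (suc n) = cong₂ _+_ (ball-1 n) (ball-0 n)

ball-2 : ∀ n → ball n 2 ≡ n + 1
ball-2 zero    = refl
ball-2 (suc n) = trans (cong₂ _+_ (ball-2 n) (ball-1 n)) (+-comm (n + 1) 1)

-- The threshold `k` is left general because the induction lowers it for the intersection families.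
-- The bound is attained by the sets with fewer than `k` elements against all subsets.
count*count≤ball : {P : Pred (Subset n) ℓ} {Q : Pred (Subset n) ℓ′}
  (k : ℕ) (P? : Decidable P) (Q? : Decidable Q) →
  (∀ A B → P A → Q B → ∣ A ∩ B ∣ < k) →
  count P? * count Q? ≤ ball n k * 2 ^ n
count*count≤ball {n = zero} k P? Q? small with P? [] | Q? []
... | no  _ | _     = z≤n
... | yes _ | no  _ = z≤n
-- Both families contain the empty set, so `0 < k`; hence `k` is a successor and `ball zero k` is 1.
... | yes p | yes q with s≤s _ ← small [] [] p q = ≤-refl
count*count≤ball {n = suc n} {P = P} {Q = Q} k P? Q? small = begin
  (count P₀? + count P₁?) * (count Q₀? + count Q₁?) ≡⟨ cong₂ _*_ (count-∪-∩ P₀? P₁?) (count-∪-∩ Q₀? Q₁?) ⟩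
  (u + i) * (v + j)                                 ≤⟨ chebyshev (∩≤∪ P₀? P₁?) (∩≤∪ Q₀? Q₁?) ⟩
  2 * (u * v + i * j)                               ≤⟨ *-monoʳ-≤ 2 (+-mono-≤ uv≤ ij≤) ⟩
  2 * (ball n k * 2 ^ n + ball n (pred k) * 2 ^ n)  ≡⟨ factor (ball n k) (ball n (pred k)) (2 ^ n) ⟩
  (ball n k + ball n (pred k)) * 2 ^ suc n          ∎
  where
  open ≤-Reasoning
  P₀? = P? ∘ (outside ∷_)
  P₁? = P? ∘ (inside ∷_)
  Q₀? = Q? ∘ (outside ∷_)
  Q₁? = Q? ∘ (inside ∷_)
  u = count (P₀? ∪? P₁?)
  i = count (P₀? ∩? P₁?)
  v = count (Q₀? ∪? Q₁?)
  j = count (Q₀? ∩? Q₁?)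

  ∩≤∪ : ∀ {ℓ ℓ′} {R : Pred (Subset n) ℓ} {S : Pred (Subset n) ℓ′}
    (R? : Decidable R) (S? : Decidable S) → count (R? ∩? S?) ≤ count (R? ∪? S?)
  ∩≤∪ R? S? = count-mono (R? ∩? S?) (R? ∪? S?) λ { (r , _) → inj₁ r }

  uv≤ : u * v ≤ ball n k * 2 ^ n
  uv≤ = count*count≤ball k (P₀? ∪? P₁?) (Q₀? ∪? Q₁?) λ where
    A B (inj₁ a) (inj₁ b) → small (outside ∷ A) (outside ∷ B) a b
    A B (inj₁ a) (inj₂ b) → small (outside ∷ A) (inside ∷ B) a b
    A B (inj₂ a) (inj₁ b) → small (inside ∷ A) (outside ∷ B) a b
    -- Both original sets contain the removed element, so `small` bounds `suc ∣ A ∩ B ∣`.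
    A B (inj₂ a) (inj₂ b) → <-trans (n<1+n _) (small (inside ∷ A) (inside ∷ B) a b)

  ij≤ : i * j ≤ ball n (pred k) * 2 ^ n
  ij≤ = count*count≤ball (pred k) (P₀? ∩? P₁?) (Q₀? ∩? Q₁?) λ where
    -- Taking both sets with the removed element gives `suc ∣ A ∩ B ∣ < k`; lowering both sides by
    -- one gives the bound for `pred k`.
    A B (_ , a) (_ , b) → pred-mono-≤ (small (inside ∷ A) (inside ∷ B) a b)

  factor : ∀ a b c → 2 * (a * c + b * c) ≡ (a + b) * (2 * c)
  factor = solve-∀

mainTheorem3 : (n : ℕ) (𝒜 ℬ : List (Subset n)) → Unique 𝒜 → Unique ℬ →
    (∀ {A B : Subset n} → A ∈ 𝒜 → B ∈ ℬ → ∣ A ∩ B ∣ ≤ 1) →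
    length 𝒜 * length ℬ ≤ (n + 1) * 2 ^ n
mainTheorem3 n 𝒜 ℬ unique𝒜 uniqueℬ small = begin
  length 𝒜 * length ℬ               ≤⟨ *-mono-≤ (length≤count 𝒜 unique𝒜) (length≤count ℬ uniqueℬ) ⟩
  -- The threshold is strict, so intersections of size at most 1 correspond to `k = 2`.
  count (_∈? 𝒜) * count (_∈? ℬ)     ≤⟨ count*count≤ball 2 (_∈? 𝒜) (_∈? ℬ) (λ _ _ a b → s≤s (small a b)) ⟩
  ball n 2 * 2 ^ n                  ≡⟨ cong (_* 2 ^ n) (ball-2 n) ⟩
  (n + 1) * 2 ^ n                   ∎
  where open ≤-Reasoning
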